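{- Let $T=S_{3,1,\dots,1}$ be a spider with one leg of 3 edges and all other legs of 1 edge, with $\Delta(T)\ge 4$. Then $\mathrm{ex}_c(n,T)=\lfloor \frac{(\Delta(T)-1)n}{2}\rfloor$ for all sufficiently large $n$.
   Context: $\mathrm{ex}_c(n,F)$ denotes the largest number of edges in a connected $n$-vertex graph containing no subgraph isomorphic to $F$. A spider $S_{a_1,\dots,a_j}$ ($j\ge 3$) is the tree obtained from $j$ paths with $a_1,\dots,a_j$ edges by identifying one endpoint of each path; its maximum degree is $j$. $\Delta(T)$ is the maximum degree of $T$. -}

module Defs where

open import Data.Nat using (ℕ; zero; suc; _+_; _*_; _∸_; _<ᵇ_; _≤_)
open import Data.Bool using (Bool; true; false; if_then_else_; _∨_)
open import Data.Bool.Properties using (∨-comm)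
open import Data.Fin using (Fin; toℕ)
open import Data.List using (List; map; allFin)
open import Data.Nat.ListAction using (sum)
open import Data.Empty using (⊥)
open import Data.Product using (Σ; _×_)
open import Function.Definitions using (Injective)
open import Relation.Binary.PropositionalEquality using (_≡_; refl)

record Graph (n : ℕ) : Set where
  field
    adj   : Fin n → Fin n → Bool
    sym   : ∀ u v → adj u v ≡ adj v u
    irrefl : ∀ u → adj u u ≡ false
open Graph public

edgeCount : ∀ {n} → Graph n → ℕ
edgeCount {n} G =
  sum (map (λ u → sum (map (λ v →
        if (toℕ u <ᵇ toℕ v) then (if adj G u v then 1 else 0) else 0)
      (allFin n))) (allFin n))

data Reachable {n : ℕ} (G : Graph n) : Fin n → Fin n → Set where
  here : ∀ {u} → Reachable G u u
  step : ∀ {u v w} → adj G u v ≡ true → Reachable G v w → Reachable G u w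

Connected : ∀ {n} → Graph n → Set
Connected G = ∀ u v → Reachable G u v

Contains : ∀ {n m} → Graph n → Graph m → Set
Contains {n} {m} G F =
  Σ (Fin m → Fin n) λ f →
    Injective _≡_ _≡_ f × (∀ a b → adj F a b ≡ true → adj G (f a) (f b) ≡ true)

ExC≡ : ∀ {m} → ℕ → Graph m → ℕ → Set
ExC≡ n F e =
  (Σ (Graph n) λ G → Connected G × (Contains G F → ⊥) × (edgeCount G ≡ e))
  × (∀ (G : Graph n) → Connected G → (Contains G F → ⊥) → edgeCount G ≤ e)

-- The spider S_{3,1,...,1} with j legs (one leg of 3 edges, j-1 legs of 1 edge).
-- Vertices 0..j+2: 0 is the centre, 0-1-2-3 is the long leg,
-- and 4,...,j+2 are the leaves of the j-1 short legs.
private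
  e : ℕ → ℕ → Bool
  e 0 1 = true
  e 1 2 = true
  e 2 3 = true
  e 0 (suc (suc (suc (suc _)))) = true
  e _ _ = false

  e-irr : ∀ a → e a a ≡ false
  e-irr 0 = refl
  e-irr 1 = refl
  e-irr 2 = refl
  e-irr 3 = refl
  e-irr (suc (suc (suc (suc a)))) = refl

  or-self : ∀ b → b ∨ b ≡ false → b ≡ false
  or-self false _ = refl

spider3 : (j : ℕ) → Graph (j + 3)
spider3 j = record
  { adj = λ u v → e (toℕ u) (toℕ v) ∨ e (toℕ v) (toℕ u)
  ; sym = λ u v → ∨-comm (e (toℕ u) (toℕ v)) (e (toℕ v) (toℕ u))
  ; irrefl = λ u → irr (toℕ u)
  }
  where
    irr : ∀ a → e a a ∨ e a a ≡ false
    irr a rewrite e-irr a = refl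

{-# OPTIONS --safe #-}
module Submission where

-- Upper bound. If all degrees are below j, count half-edges. Otherwise let v have degree at least
-- j. A vertex at distance 3 from v would give a path v - a - b - c with b and c not adjacent to v,
-- and j - 1 other neighbours of v complete it to a spider; so every vertex is within distance 2
-- of v. If all degrees are at most j + 1, this bounds n. If some v has degree at least j + 2, then
-- any 3-edge path from v extends to a spider, so there is none, and G has at most 3n/2 edges.
--
-- Lower bound. A connected graph whose degrees are all j - 1, except possibly one equal to j - 2:
-- write j - 1 = 2m + ε and take a circulant graph of degree 2m, together with the matching
-- {0,1}, {2,3}, ... when ε = 1.

open import Defs
open import Data.Nat using (ℕ; zero; suc; _+_; _*_; _∸_; _≤_; _<_; _<ᵇ_; _≤?_; _<?_; z≤n; s≤s; ∣_-_∣; ⌊_/2⌋)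
open import Data.Nat.DivMod using (_/_; /-monoˡ-≤; m*n/n≡m; m<n*o⇒m/o<n)
open import Data.Nat.Induction using (<-rec)
open import Data.Nat.Properties hiding (_≟_; _≤?_; _<?_; suc-injective)
open import Data.Bool using (Bool; true; false; if_then_else_; _∧_; _∨_; not; T)
open import Data.Bool.Properties using (¬-not; ∨-comm; ∨-zeroʳ) renaming (_≟_ to _≟ᵇ_)
open import Data.Empty using (⊥; ⊥-elim)
open import Data.Fin using (Fin; zero; suc; toℕ; fromℕ<; cast)
open import Data.Fin.Properties using (_≟_; any?; suc-injective; toℕ<n; toℕ-cast; toℕ-fromℕ<; toℕ-injective)
open import Data.List using (allFin; map; tabulate)
open import Data.List.Properties using (map-tabulate)
open import Data.Product using (Σ; ∃; _×_; _,_; proj₁; proj₂)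
open import Data.Sum using (_⊎_; inj₁; inj₂; [_,_]′)
open import Data.Unit using (tt)
open import Data.Vec.Functional using (Vector; _∷_)
open import Function using (_∘_)
open import Function.Definitions using (Injective)
open import Relation.Nullary using (¬_; Dec; yes; no; does; contradiction)
open import Relation.Nullary.Decidable using (dec-true; dec-false; _⊎-dec_; _×-dec_)
open import Relation.Binary.Definitions using (tri<; tri≈; tri>)
open import Relation.Binary.PropositionalEquality
  using (_≡_; _≢_; refl; cong; cong₂; trans; subst; subst₂; module ≡-Reasoning) renaming (sym to ≡-sym)
open import Algebra.Properties.Semiring.Sum +-*-semiring
  using (sum; sum-cong-≗; ∑-distrib-+; ∑-comm; *-distribˡ-sum; *-distribʳ-sum; sum-replicate-zero)
import Data.Nat.ListAction as List

-- Finite sums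

⟦_⟧ : Bool → ℕ
⟦ b ⟧ = if b then 1 else 0

δ : ∀ {n} → Fin n → Fin n → ℕ
δ x w = ⟦ does (x ≟ w) ⟧

sum-mono : ∀ {n} {f g : Vector ℕ n} → (∀ i → f i ≤ g i) → sum f ≤ sum g
sum-mono {zero}  p = z≤n
sum-mono {suc n} p = +-mono-≤ (p zero) (sum-mono (p ∘ suc))

sum-const : ∀ n c → sum {n} (λ _ → c) ≡ n * c
sum-const zero    c = refl
sum-const (suc n) c = cong (c +_) (sum-const n c)

sum-δ : ∀ {n} (x : Fin n) → sum (δ x) ≡ 1
sum-δ {suc n} zero    = cong suc (sum-replicate-zero n)
sum-δ {suc n} (suc x) = sum-δ x

sum-*δ : ∀ {n} c (x : Fin n) → sum (λ w → c * δ x w) ≡ c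
sum-*δ c x = trans (≡-sym (*-distribˡ-sum c (δ x))) (trans (cong (c *_) (sum-δ x)) (*-identityʳ c))

sum-allFin : ∀ {n} (f : Vector ℕ n) → List.sum (map f (allFin n)) ≡ sum f
sum-allFin f = trans (cong List.sum (map-tabulate (λ i → i) f)) (go f)
  where
  go : ∀ {n} (f : Vector ℕ n) → List.sum (tabulate f) ≡ sum f
  go {zero}  f = refl
  go {suc n} f = cong (f zero +_) (go (f ∘ suc))

count : ∀ {n} → (Fin n → Bool) → ℕ
count P = sum (⟦_⟧ ∘ P)

choose : ∀ {n} (P : Fin n → Bool) {m} → m ≤ count P →
         Σ (Fin m → Fin n) λ f → Injective _≡_ _≡_ f × (∀ i → P (f i) ≡ true)
choose {n} P {zero} _ = (λ ()) , (λ { {()} }) , λ ()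
choose {suc n} P {suc m} le with P zero in eq
... | false with choose (P ∘ suc) le
...   | f , inj , ok = suc ∘ f , inj ∘ suc-injective , ok
choose {suc n} P {suc m} (s≤s le) | true with choose (P ∘ suc) le
...   | f , inj , ok = f′ , inj′ , ok′
  where
  f′ : Fin (suc m) → Fin (suc n)
  f′ zero    = zero
  f′ (suc i) = suc (f i)
  inj′ : Injective _≡_ _≡_ f′
  inj′ {zero}  {zero}  _ = refl
  inj′ {suc _} {suc _} e = cong suc (inj (suc-injective e))
  ok′ : ∀ i → P (f′ i) ≡ true
  ok′ zero    = eq
  ok′ (suc i) = ok i

δ-refl : ∀ {n} (x : Fin n) → δ x x ≡ 1
δ-refl x with x ≟ x
... | yes _ = refl
... | no ne = contradiction refl ne

δ-≢ : ∀ {n} {x y : Fin n} → x ≢ y → δ x y ≡ 0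
δ-≢ {x = x} {y} ne with x ≟ y
... | yes e = contradiction e ne
... | no _  = refl

-- Double counting of the pairs `(i, w)` with `f i ≡ w`: each `i` lies in exactly one pair, and each
-- `w` in at most one, and in none unless `P w` holds.
injective⇒≤count : ∀ {n m} (P : Fin n → Bool) (f : Fin m → Fin n) →
  Injective _≡_ _≡_ f → (∀ i → P (f i) ≡ true) → m ≤ count P
injective⇒≤count {n} {m} P f inj ok = begin
  m                                ≡⟨ *-identityʳ m ⟨
  m * 1                            ≡⟨ sum-const m 1 ⟨
  sum {m} (λ i → 1)                ≡⟨ sum-cong-≗ (λ i → ≡-sym (sum-δ (f i))) ⟩
  sum (λ i → sum (δ (f i)))        ≡⟨ ∑-comm (λ i → δ (f i)) ⟩
  sum (λ w → sum (λ i → δ (f i) w)) ≤⟨ sum-mono fibre ⟩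
  count P ∎
  where
  open ≤-Reasoning
  fibre : ∀ w → sum (λ i → δ (f i) w) ≤ ⟦ P w ⟧
  fibre w with any? (λ i → f i ≟ w)
  ... | yes (i , refl) rewrite ok i = begin
    sum (λ k → δ (f k) (f i)) ≤⟨ sum-mono le ⟩
    sum (δ i)                 ≡⟨ sum-δ i ⟩
    1                         ∎
    where
    le : ∀ k → δ (f k) (f i) ≤ δ i k
    le k with f k ≟ f i
    ... | no _  = z≤n
    ... | yes e rewrite inj e | δ-refl i = ≤-refl
  ... | no ¬p = begin
    sum (λ k → δ (f k) w) ≡⟨ sum-cong-≗ (λ k → δ-≢ (λ e → ¬p (k , e))) ⟩
    sum {m} (λ k → 0)     ≡⟨ sum-replicate-zero m ⟩
    0                     ≤⟨ z≤n ⟩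
    ⟦ P w ⟧               ∎

-- An edge weight f may be shifted between the two orientations of an edge.
sum-reorient : ∀ {n} (f g : Fin n → Fin n → ℕ) → (∀ u w → f u w + f w u ≡ g u w + g w u) →
               sum (λ u → sum (f u)) ≡ sum (λ u → sum (g u))
-- Adding the transpose doubles each total; the doubled sums agree term by term.
sum-reorient f g eq = *-cancelˡ-≡ _ _ 2 (trans (≡-sym (double f))
    (trans (sum-cong-≗ λ u → sum-cong-≗ λ w → eq u w) (double g)))
  where
  double : ∀ f → sum (λ u → sum (λ w → f u w + f w u)) ≡ 2 * sum (λ u → sum (f u))
  double f = begin
    sum (λ u → sum (λ w → f u w + f w u))
      ≡⟨ sum-cong-≗ (λ u → ∑-distrib-+ (f u) (λ w → f w u)) ⟩
    sum (λ u → sum (f u) + sum (λ w → f w u))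
      ≡⟨ ∑-distrib-+ (λ u → sum (f u)) (λ u → sum (λ w → f w u)) ⟩
    sum (λ u → sum (f u)) + sum (λ u → sum (λ w → f w u))
      ≡⟨ cong (sum (λ u → sum (f u)) +_) (∑-comm (λ u w → f w u)) ⟩
    sum (λ u → sum (f u)) + sum (λ u → sum (f u))
      ≡⟨ cong (sum (λ u → sum (f u)) +_) (+-identityʳ _) ⟨
    2 * sum (λ u → sum (f u)) ∎
    where open ≡-Reasoning

-- Degrees and the handshake identity

deg : ∀ {n} → Graph n → Fin n → ℕ
deg G u = count (adj G u)

-- `edgeCount` sees an edge only in its orientation of increasing index. Weight 2 there is traded
-- for weight 1 on each orientation.
handshake : ∀ {n} (G : Graph n) → 2 * edgeCount G ≡ sum (deg G)
handshake {n} G = begin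
  2 * edgeCount G               ≡⟨ cong (2 *_) (sum-allFin {n} _) ⟩
  2 * sum {n} _                 ≡⟨ cong (2 *_) (sum-cong-≗ {n} (λ u → sum-allFin {n} _)) ⟩
  2 * sum (λ u → sum (h u))     ≡⟨ *-distribˡ-sum 2 (λ u → sum (h u)) ⟩
  sum (λ u → 2 * sum (h u))     ≡⟨ sum-cong-≗ (λ u → *-distribˡ-sum 2 (h u)) ⟩
  sum (λ u → sum (λ w → 2 * h u w)) ≡⟨ sum-reorient (λ u w → 2 * h u w) (λ u w → ⟦ adj G u w ⟧) pair ⟩
  sum (deg G) ∎
  where
  open ≡-Reasoning
  h : Fin n → Fin n → ℕ
  h u w = if (toℕ u <ᵇ toℕ w) then (if adj G u w then 1 else 0) else 0
  pair : ∀ u w → 2 * h u w + 2 * h w u ≡ ⟦ adj G u w ⟧ + ⟦ adj G w u ⟧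
  pair u w with u ≟ w
  ... | yes refl rewrite irrefl G u with toℕ u <ᵇ toℕ u
  ...   | true  = refl
  ...   | false = refl
  pair u w | no ne with <-cmp (toℕ u) (toℕ w)
  ... | tri≈ _ e _ = contradiction (toℕ-injective e) ne
  ... | tri< u<w _ w≮u
      rewrite dec-true (toℕ u <? toℕ w) u<w | dec-false (toℕ w <? toℕ u) w≮u | Graph.sym G w u
    with adj G u w
  ...   | true  = refl
  ...   | false = refl
  pair u w | no ne | tri> u≮w _ w<u
      rewrite dec-false (toℕ u <? toℕ w) u≮w | dec-true (toℕ w <? toℕ u) w<u | Graph.sym G w u
    with adj G u w
  ...   | true  = refl
  ...   | false = refl

-- The spider

∷-injective : ∀ {a} {A : Set a} {m} {x : A} {f : Vector A m} →
  (∀ i → f i ≢ x) → Injective _≡_ _≡_ f → Injective _≡_ _≡_ (x ∷ f)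
∷-injective ne inj {zero}  {zero}  e = refl
∷-injective ne inj {zero}  {suc j} e = contradiction (≡-sym e) (ne j)
∷-injective ne inj {suc i} {zero}  e = contradiction e (ne i)
∷-injective ne inj {suc i} {suc j} e = cong suc (inj e)

adjacent⇒≢ : ∀ {n} (G : Graph n) {u w} → adj G u w ≡ true → u ≢ w
adjacent⇒≢ G {u} e refl = contradiction (trans (≡-sym e) (irrefl G u)) λ ()

flip-adj : ∀ {n} (G : Graph n) {u w} → adj G u w ≡ true → adj G w u ≡ true
flip-adj G e = trans (Graph.sym G _ _) e

-- Short legs available at v once the long leg v - a - b - c has been chosen.
leaf : ∀ {n} → Graph n → (v a b c : Fin n) → Fin n → Bool
leaf G v a b c w = adj G v w ∧ not (does (a ≟ w) ∨ does (b ≟ w) ∨ does (c ≟ w))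

leaf-sound : ∀ {n} (G : Graph n) v a b c w → leaf G v a b c w ≡ true →
             adj G v w ≡ true × w ≢ a × w ≢ b × w ≢ c
leaf-sound G v a b c w p with adj G v w | a ≟ w | b ≟ w | c ≟ w
... | true | no w≢a | no w≢b | no w≢c = refl , w≢a ∘ ≡-sym , w≢b ∘ ≡-sym , w≢c ∘ ≡-sym

-- Listing `v, a, b, c` before the leaves matches the numbering of `spider3`. The three inequalities
-- are the distinctness conditions on the long leg that adjacency does not supply; `leaf` keeps the
-- `3 + j` short legs off it.
spider-embeds : ∀ {n} (G : Graph n) j {v a b c} →
  adj G v a ≡ true → adj G a b ≡ true → adj G b c ≡ true → b ≢ v → c ≢ v → c ≢ a →
  j + 3 ≤ count (leaf G v a b c) → Contains G (spider3 (4 + j))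
spider-embeds G j {v} {a} {b} {c} va ab bc b≢v c≢v c≢a le with choose (leaf G v a b c) le
... | l , l-inj , l-ok = f , f-inj , f-adj
  where
  f : Fin (4 + (j + 3)) → Fin _
  f = v ∷ a ∷ b ∷ c ∷ l
  ok : ∀ i → adj G v (l i) ≡ true × l i ≢ a × l i ≢ b × l i ≢ c
  ok i = leaf-sound G v a b c (l i) (l-ok i)
  f-inj : Injective _≡_ _≡_ f
  f-inj = ∷-injective ne₀ (∷-injective ne₁ (∷-injective ne₂ (∷-injective ne₃ l-inj)))
    where
    ne₃ : ∀ i → l i ≢ c
    ne₃ i = proj₂ (proj₂ (proj₂ (ok i)))
    ne₂ : ∀ i → (c ∷ l) i ≢ b
    ne₂ zero    = adjacent⇒≢ G bc ∘ ≡-sym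
    ne₂ (suc i) = proj₁ (proj₂ (proj₂ (ok i)))
    ne₁ : ∀ i → (b ∷ c ∷ l) i ≢ a
    ne₁ zero          = adjacent⇒≢ G ab ∘ ≡-sym
    ne₁ (suc zero)    = c≢a
    ne₁ (suc (suc i)) = proj₁ (proj₂ (ok i))
    ne₀ : ∀ i → (a ∷ b ∷ c ∷ l) i ≢ v
    ne₀ zero                = adjacent⇒≢ G va ∘ ≡-sym
    ne₀ (suc zero)          = b≢v
    ne₀ (suc (suc zero))    = c≢v
    ne₀ (suc (suc (suc i))) = adjacent⇒≢ G (proj₁ (ok i)) ∘ ≡-sym
  f-adj : ∀ p q → adj (spider3 (4 + j)) p q ≡ true → adj G (f p) (f q) ≡ true
  f-adj zero (suc zero) _ = va
  f-adj zero (suc (suc (suc (suc i)))) _ = proj₁ (ok i)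
  f-adj (suc zero) zero _ = flip-adj G va
  f-adj (suc zero) (suc (suc zero)) _ = ab
  f-adj (suc (suc zero)) (suc zero) _ = flip-adj G ab
  f-adj (suc (suc zero)) (suc (suc (suc zero))) _ = bc
  f-adj (suc (suc (suc zero))) (suc (suc zero)) _ = flip-adj G bc
  f-adj (suc (suc (suc (suc i)))) zero _ = flip-adj G (proj₁ (ok i))
  f-adj zero zero ()
  f-adj zero (suc (suc zero)) ()
  f-adj zero (suc (suc (suc zero))) ()
  f-adj (suc zero) (suc zero) ()
  f-adj (suc zero) (suc (suc (suc i))) ()
  f-adj (suc (suc zero)) zero ()
  f-adj (suc (suc zero)) (suc (suc zero)) ()
  f-adj (suc (suc zero)) (suc (suc (suc (suc i)))) ()
  f-adj (suc (suc (suc zero))) zero ()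
  f-adj (suc (suc (suc zero))) (suc zero) ()
  f-adj (suc (suc (suc zero))) (suc (suc (suc i))) ()
  f-adj (suc (suc (suc (suc i)))) (suc zero) ()
  f-adj (suc (suc (suc (suc i)))) (suc (suc zero)) ()
  f-adj (suc (suc (suc (suc i)))) (suc (suc (suc zero))) ()
  f-adj (suc (suc (suc (suc i)))) (suc (suc (suc (suc k)))) ()

-- The image of the centre has the images of vertex 1 and of all the leaves as distinct neighbours.
-- Hence a graph with all degrees at most `3 + j` is spider-free.
spider⇒degree : ∀ {n} (G : Graph n) j → Contains G (spider3 (4 + j)) → ∃ λ v → 4 + j ≤ deg G v
spider⇒degree G j (f , f-inj , f-adj) =
  f zero , injective⇒≤count (adj G (f zero)) (f ∘ nbr) (nbr-inj ∘ f-inj) λ i → f-adj zero (nbr i) (nbr-adj i)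
  where
  nbr : Fin (4 + j) → Fin (4 + (j + 3))
  nbr zero    = suc zero
  nbr (suc i) = suc (suc (suc (suc (cast (+-comm 3 j) i))))
  nbr-inj : Injective _≡_ _≡_ nbr
  nbr-inj {zero}  {zero}  e = refl
  nbr-inj {suc i} {suc k} e = cong suc (cast-inj (suc-injective (suc-injective (suc-injective (suc-injective e)))))
    where
    cast-inj : cast (+-comm 3 j) i ≡ cast (+-comm 3 j) k → i ≡ k
    cast-inj e = toℕ-injective (trans (≡-sym (toℕ-cast _ i)) (trans (cong toℕ e) (toℕ-cast _ k)))
  nbr-adj : ∀ i → adj (spider3 (4 + j)) zero (nbr i) ≡ true
  nbr-adj zero    = refl
  nbr-adj (suc i) = refl

-- Upper bound

Within2 : ∀ {n} → Graph n → Fin n → Fin n → Set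
Within2 G v u = v ≡ u ⊎ adj G v u ≡ true ⊎ ∃ λ a → adj G v a ≡ true × adj G a u ≡ true

within2? : ∀ {n} (G : Graph n) v u → Dec (Within2 G v u)
within2? G v u = (v ≟ u) ⊎-dec (adj G v u ≟ᵇ true) ⊎-dec
                 any? λ a → (adj G v a ≟ᵇ true) ×-dec (adj G a u ≟ᵇ true)

-- The walk is followed up to its first edge that leaves `P`. With `P` being `Within2 G v`, this
-- edge is the end of a long leg at `v`.
reachable-exit : ∀ {n} (G : Graph n) {P : Fin n → Set} → (∀ u → Dec (P u)) → ∀ {u w} →
  Reachable G u w → P u → ¬ P w → ∃ λ p → ∃ λ q → P p × adj G p q ≡ true × ¬ P q
reachable-exit G P? here                   pu ¬pw = contradiction pu ¬pw
reachable-exit G P? (step {v = x} ux path) pu ¬pw with P? x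
... | yes px = reachable-exit G P? path px ¬pw
... | no ¬px = _ , x , pu , ux , ¬px

bool≤1 : ∀ b → ⟦ b ⟧ ≤ 1
bool≤1 true  = ≤-refl
bool≤1 false = z≤n

-- A neighbour of `v` is lost as a short leg only if it is `a`, `b` or `c`, and each of these costs
-- something only when it is adjacent to `v`.
degree≤leaves : ∀ {n} (G : Graph n) v a b c →
  deg G v ≤ count (leaf G v a b c) + (⟦ adj G v a ⟧ + (⟦ adj G v b ⟧ + ⟦ adj G v c ⟧))
degree≤leaves {n} G v a b c = begin
  deg G v ≤⟨ sum-mono pointwise ⟩
  sum (λ w → ⟦ leaf G v a b c w ⟧ + (δ′ a w + (δ′ b w + δ′ c w)))
    ≡⟨ ∑-distrib-+ (⟦_⟧ ∘ leaf G v a b c) _ ⟩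
  L + sum (λ w → δ′ a w + (δ′ b w + δ′ c w))
    ≡⟨ cong (L +_) (∑-distrib-+ (δ′ a) _) ⟩
  L + (sum (δ′ a) + sum (λ w → δ′ b w + δ′ c w))
    ≡⟨ cong (λ s → L + (sum (δ′ a) + s)) (∑-distrib-+ (δ′ b) (δ′ c)) ⟩
  L + (sum (δ′ a) + (sum (δ′ b) + sum (δ′ c)))
    ≡⟨ cong (L +_) (cong₂ _+_ (sum-*δ ⟦ adj G v a ⟧ a)
         (cong₂ _+_ (sum-*δ ⟦ adj G v b ⟧ b) (sum-*δ ⟦ adj G v c ⟧ c))) ⟩
  L + (⟦ adj G v a ⟧ + (⟦ adj G v b ⟧ + ⟦ adj G v c ⟧)) ∎
  where
  open ≤-Reasoning
  L = count (leaf G v a b c)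
  δ′ : Fin n → Fin n → ℕ
  δ′ x w = ⟦ adj G v x ⟧ * δ x w
  pointwise : ∀ w → ⟦ adj G v w ⟧ ≤ ⟦ leaf G v a b c w ⟧ + (δ′ a w + (δ′ b w + δ′ c w))
  pointwise w with adj G v w in eq
  ... | false = z≤n
  ... | true with a ≟ w
  ...   | yes refl rewrite eq = s≤s z≤n
  ...   | no _ with b ≟ w
  ...     | yes refl rewrite eq = ≤-trans (s≤s z≤n) (m≤n+m _ _)
  ...     | no _ with c ≟ w
  ...       | yes refl rewrite eq =
              ≤-trans (≤-trans (s≤s z≤n) (m≤n+m _ (⟦ adj G v b ⟧ * 0))) (m≤n+m _ (⟦ adj G v a ⟧ * 0))
  ...       | no _ = s≤s z≤n

far⇒spider : ∀ {n} (G : Graph n) j {v p q} → 4 + j ≤ deg G v →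
  Within2 G v p → adj G p q ≡ true → ¬ Within2 G v q → Contains G (spider3 (4 + j))
far⇒spider G j d (inj₁ refl)      pq far = contradiction (inj₂ (inj₁ pq)) far
far⇒spider G j d (inj₂ (inj₁ vp)) pq far = contradiction (inj₂ (inj₂ (_ , vp , pq))) far
far⇒spider G j {v} {p} {q} d (inj₂ (inj₂ (a , va , ap))) pq far =
  spider-embeds G j va ap pq
    (λ { refl → far (inj₂ (inj₁ pq)) }) (λ { refl → far (inj₁ refl) }) (λ { refl → far (inj₂ (inj₁ va)) })
    -- Neither `p` nor `q` is adjacent to `v`, so the long leg uses up only the neighbour `a`.
    (+-cancelʳ-≤ 1 _ _ (begin
      j + 3 + 1 ≡⟨ +-assoc j 3 1 ⟩
      j + 4     ≡⟨ +-comm j 4 ⟩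
      4 + j     ≤⟨ d ⟩
      deg G v   ≤⟨ degree≤leaves G v a p q ⟩
      L + (⟦ adj G v a ⟧ + (⟦ adj G v p ⟧ + ⟦ adj G v q ⟧))
        ≡⟨ cong (L +_) (cong₂ _+_ (cong ⟦_⟧ va) (cong₂ _+_ (cong ⟦_⟧ v≁p) (cong ⟦_⟧ v≁q))) ⟩
      L + 1 ∎))
  where
  open ≤-Reasoning
  L = count (leaf G v a p q)
  v≁p : adj G v p ≡ false
  v≁p = ¬-not (λ vp → far (inj₂ (inj₂ (p , vp , pq))))
  v≁q : adj G v q ≡ false
  v≁q = ¬-not (λ vq → far (inj₂ (inj₁ vq)))

spider-free⇒within2 : ∀ {n} (G : Graph n) j → Connected G → ¬ Contains G (spider3 (4 + j)) →
  ∀ v → 4 + j ≤ deg G v → ∀ u → Within2 G v u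
spider-free⇒within2 G j conn free v d u with within2? G v u
... | yes near = near
... | no far with reachable-exit G (within2? G v) (conn v u) (inj₁ refl) far
...   | p , q , near-p , pq , far-q = contradiction (far⇒spider G j d near-p pq far-q) free

-- A crude Moore bound: the vertices are covered by `v`, its neighbours and the ends of walks of
-- length 2 from `v`, at most `D * D` in number.
within2⇒small : ∀ {n} (G : Graph n) D v → (∀ u → deg G u ≤ D) → (∀ u → Within2 G v u) →
                n ≤ 1 + (D + D * D)
within2⇒small {n} G D v small near = begin
  n                        ≡⟨ *-identityʳ n ⟨
  n * 1                    ≡⟨ sum-const n 1 ⟨
  sum {n} (λ _ → 1)        ≤⟨ sum-mono cover ⟩
  sum (λ u → δ v u + (A v u + via u))
    ≡⟨ ∑-distrib-+ (δ v) _ ⟩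
  sum (δ v) + sum (λ u → A v u + via u)
    ≡⟨ cong₂ _+_ (sum-δ v) (∑-distrib-+ (A v) via) ⟩
  1 + (deg G v + sum via)
    ≡⟨ cong (λ s → 1 + (deg G v + s)) (∑-comm (λ u a → A v a * A a u)) ⟩
  1 + (deg G v + sum (λ a → sum (λ u → A v a * A a u)))
    ≡⟨ cong (λ s → 1 + (deg G v + s)) (sum-cong-≗ λ a → *-distribˡ-sum (A v a) (A a)) ⟨
  1 + (deg G v + sum (λ a → A v a * deg G a))
    ≤⟨ +-monoʳ-≤ 1 (+-mono-≤ (small v) (sum-mono λ a → *-monoʳ-≤ (A v a) (small a))) ⟩
  1 + (D + sum (λ a → A v a * D))
    ≡⟨ cong (λ s → 1 + (D + s)) (*-distribʳ-sum D (A v)) ⟨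
  1 + (D + deg G v * D)
    ≤⟨ +-monoʳ-≤ 1 (+-monoʳ-≤ D (*-monoˡ-≤ D (small v))) ⟩
  1 + (D + D * D) ∎
  where
  open ≤-Reasoning
  A : Fin n → Fin n → ℕ
  A u w = ⟦ adj G u w ⟧
  via : Fin n → ℕ
  via u = sum (λ a → A v a * A a u)
  term≤sum : ∀ {n} (f : Vector ℕ n) i → f i ≤ sum f
  term≤sum f zero    = m≤m+n _ _
  term≤sum f (suc i) = ≤-trans (term≤sum (f ∘ suc) i) (m≤n+m _ _)
  cover : ∀ u → 1 ≤ δ v u + (A v u + via u)
  cover u with near u
  ... | inj₁ refl rewrite δ-refl v = s≤s z≤n
  ... | inj₂ (inj₁ vu) rewrite vu = ≤-trans (s≤s z≤n) (m≤n+m _ (δ v u))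
  ... | inj₂ (inj₂ (a , va , au)) = begin
    1                       ≡⟨ cong₂ (λ x y → ⟦ x ⟧ * ⟦ y ⟧) va au ⟨
    A v a * A a u           ≤⟨ term≤sum (λ a → A v a * A a u) a ⟩
    via u                   ≤⟨ m≤n+m _ (A v u) ⟩
    A v u + via u           ≤⟨ m≤n+m _ (δ v u) ⟩
    δ v u + (A v u + via u) ∎

-- Vertices with no 3-edge path starting from them

-- The weight that an end in layer `k` gets from an edge whose other end is in layer `l`: 2 if
-- `k > l`, 1 if `k ≡ l`, 0 if `k < l`.
share : ℕ → ℕ → ℕ
share zero    zero    = 1
share zero    (suc _) = 0
share (suc _) zero    = 2
share (suc k) (suc l) = share k l

share-pair : ∀ k l → share k l + share l k ≡ 2
share-pair zero    zero    = refl
share-pair zero    (suc l) = refl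
share-pair (suc k) zero    = refl
share-pair (suc k) (suc l) = share-pair k l

share≤2 : ∀ k l → share k l ≤ 2
share≤2 k l = ≤-trans (m≤m+n _ _) (≤-reflexive (share-pair k l))

-- Distance from `v`, provided every vertex is within distance 2; `outer` records only that a vertex
-- is neither `v` nor a neighbour of `v`.
data Layer {n} (G : Graph n) (v : Fin n) : Fin n → ℕ → Set where
  root  : Layer G v v 0
  inner : ∀ {u} → adj G v u ≡ true → Layer G v u 1
  outer : ∀ {u} → v ≢ u → adj G v u ≡ false → Layer G v u 2

layer : ∀ {n} (G : Graph n) v u → ∃ (Layer G v u)
layer G v u with v ≟ u
... | yes refl = 0 , root
... | no v≢u with adj G v u in eq
...   | true  = 1 , inner eq
...   | false = 2 , outer v≢u eq

-- Each edge has two units of weight, given to its end farther from v, or split evenly when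
-- both ends are equally far; without a 3-edge path from v, no vertex receives more than 3.
module _ {n} (G : Graph n) (v : Fin n) (near : ∀ u → Within2 G v u)
  (no-path : ∀ {a b c} → adj G v a ≡ true → adj G a b ≡ true → adj G b c ≡ true →
             b ≢ v → c ≢ v → c ≢ a → ⊥) where

  received : Fin n → Fin n → ℕ
  received u w = ⟦ adj G u w ⟧ * share (proj₁ (layer G v u)) (proj₁ (layer G v w))

  private
    from-root : ∀ {w l} → Layer G v w l → ⟦ adj G v w ⟧ * share 0 l ≤ 0
    from-root root rewrite irrefl G v = z≤n
    from-root {w} (inner _)   = ≤-reflexive (*-zeroʳ ⟦ adj G v w ⟧)
    from-root {w} (outer _ _) = ≤-reflexive (*-zeroʳ ⟦ adj G v w ⟧)

    -- A neighbour `u` of `v` gets 2 from the edge to `v`, at most 1 from an edge inside the layer,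
    -- where `b` is the only candidate, and 0 from outer vertices.
    from-inner : ∀ {u w l} b → (∀ {w} → adj G u w ≡ true → adj G v w ≡ true → w ≡ b) →
                 Layer G v w l → ⟦ adj G u w ⟧ * share 1 l ≤ 2 * δ v w + 1 * δ b w
    from-inner {u} b uniq root rewrite δ-refl v = ≤-trans (*-monoˡ-≤ 2 (bool≤1 (adj G u v))) (m≤m+n 2 _)
    from-inner {u} {w} b uniq (inner vw) with adj G u w in uw
    ... | false = z≤n
    ... | true with uniq uw vw
    ...   | refl rewrite δ-refl w = m≤n+m 1 _
    from-inner {u} {w} b uniq (outer _ _) = ≤-trans (≤-reflexive (*-zeroʳ ⟦ adj G u w ⟧)) z≤n

    inner-sum : ∀ {u} b → (∀ {w} → adj G u w ≡ true → adj G v w ≡ true → w ≡ b) →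
                sum (λ w → ⟦ adj G u w ⟧ * share 1 (proj₁ (layer G v w))) ≤ 3
    inner-sum {u} b uniq = begin
      sum (λ w → ⟦ adj G u w ⟧ * share 1 (proj₁ (layer G v w)))
        ≤⟨ sum-mono (λ w → from-inner b uniq (proj₂ (layer G v w))) ⟩
      sum (λ w → 2 * δ v w + 1 * δ b w)   ≡⟨ ∑-distrib-+ (λ w → 2 * δ v w) (λ w → 1 * δ b w) ⟩
      sum (λ w → 2 * δ v w) + sum (λ w → 1 * δ b w) ≡⟨ cong₂ _+_ (sum-*δ 2 v) (sum-*δ 1 b) ⟩
      3 ∎
      where open ≤-Reasoning

  received≤3 : ∀ u → sum (received u) ≤ 3
  received≤3 u with layer G v u
  ... | 0 , root = ≤-trans (sum-mono (λ w → from-root (proj₂ (layer G v w))))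
                     (≤-trans (≤-reflexive (sum-replicate-zero n)) z≤n)
  ... | 1 , inner vu with any? (λ b → (adj G u b ≟ᵇ true) ×-dec (adj G v b ≟ᵇ true))
  -- Without a common neighbour of `u` and `v` the uniqueness claim is vacuous, and `v` is an
  -- arbitrary value for `b`.
  ...   | no none = inner-sum v (λ uw vw → contradiction (_ , uw , vw) none)
  ...   | yes (b , ub , vb) = inner-sum b uniq
    where
    uniq : ∀ {w} → adj G u w ≡ true → adj G v w ≡ true → w ≡ b
    uniq {w} uw vw with w ≟ b
    ... | yes e  = e
    -- Two common neighbours `b` and `w` would give the path `v - b - u - w`.
    ... | no w≢b = ⊥-elim (no-path vb (flip-adj G ub) uw
                     (adjacent⇒≢ G vu ∘ ≡-sym) (adjacent⇒≢ G vw ∘ ≡-sym) w≢b)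
  received≤3 u | 2 , outer v≢u v≁u with near u
  ... | inj₁ e         = contradiction e v≢u
  ... | inj₂ (inj₁ vu) = contradiction (trans (≡-sym vu) v≁u) λ ()
  ... | inj₂ (inj₂ (a , va , au)) = begin
    sum (λ w → ⟦ adj G u w ⟧ * share 2 (proj₁ (layer G v w))) ≤⟨ sum-mono only-a ⟩
    sum (λ w → 2 * δ a w) ≡⟨ sum-*δ 2 a ⟩
    2 ≤⟨ s≤s (s≤s z≤n) ⟩
    3 ∎
    where
    open ≤-Reasoning
    -- An outer vertex has `a` as its only neighbour: another neighbour `w` would give the path
    -- `v - a - u - w`.
    only-a : ∀ w → ⟦ adj G u w ⟧ * share 2 (proj₁ (layer G v w)) ≤ 2 * δ a w
    only-a w with adj G u w in uw
    ... | false = z≤n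
    ... | true with a ≟ w
    ...   | yes _  = ≤-trans (≤-reflexive (+-identityʳ _)) (share≤2 2 (proj₁ (layer G v w)))
    ...   | no a≢w = ⊥-elim (no-path va au uw (v≢u ∘ ≡-sym)
                       (λ { refl → contradiction (trans (≡-sym (flip-adj G uw)) v≁u) λ () }) (a≢w ∘ ≡-sym))

  few-edges : 2 * edgeCount G ≤ 3 * n
  few-edges = begin
    2 * edgeCount G             ≡⟨ handshake G ⟩
    sum (deg G)                 ≡⟨ sum-reorient received (λ u w → ⟦ adj G u w ⟧) pair ⟨
    sum (λ u → sum (received u)) ≤⟨ sum-mono received≤3 ⟩
    sum {n} (λ _ → 3)           ≡⟨ sum-const n 3 ⟩
    n * 3                       ≡⟨ *-comm n 3 ⟩
    3 * n ∎
    where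
    open ≤-Reasoning
    pair : ∀ u w → received u w + received w u ≡ ⟦ adj G u w ⟧ + ⟦ adj G w u ⟧
    pair u w = begin-equality
      received u w + received w u   ≡⟨ cong (λ b → received u w + ⟦ b ⟧ * share l k) (Graph.sym G w u) ⟩
      A * share k l + A * share l k ≡⟨ *-distribˡ-+ A (share k l) (share l k) ⟨
      A * (share k l + share l k)   ≡⟨ cong (A *_) (share-pair k l) ⟩
      A * 2                         ≡⟨ *-comm A 2 ⟩
      A + (A + 0)                   ≡⟨ cong (A +_) (+-identityʳ A) ⟩
      A + A                         ≡⟨ cong (λ b → A + ⟦ b ⟧) (Graph.sym G u w) ⟩
      A + ⟦ adj G w u ⟧             ∎
      where
      A = ⟦ adj G u w ⟧
      k = proj₁ (layer G v u)
      l = proj₁ (layer G v w)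

-- The three ranges of the maximum degree

upper-bound : ∀ {n} (G : Graph n) j → 1 + ((5 + j) + (5 + j) * (5 + j)) < n →
  Connected G → ¬ Contains G (spider3 (4 + j)) → 2 * edgeCount G ≤ (3 + j) * n
upper-bound {n} G j large conn free with any? (λ v → 4 + j ≤? deg G v)
... | no none = begin
  2 * edgeCount G         ≡⟨ handshake G ⟩
  sum (deg G)             ≤⟨ sum-mono (λ u → ≤-pred (≰⇒> (λ le → none (u , le)))) ⟩
  sum {n} (λ _ → 3 + j)   ≡⟨ sum-const n (3 + j) ⟩
  n * (3 + j)             ≡⟨ *-comm n (3 + j) ⟩
  (3 + j) * n ∎
  where open ≤-Reasoning
... | yes (v₀ , d₀) with any? (λ v → 6 + j ≤? deg G v)
-- All degrees are now at most `5 + j` while `v₀` sees every vertex within distance 2, so `n` is at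
-- most the Moore bound that `large` exceeds.
...   | no none = contradiction
        (within2⇒small G (5 + j) v₀ (λ u → ≤-pred (≰⇒> (λ le → none (u , le))))
          (spider-free⇒within2 G j conn free v₀ d₀))
        (<⇒≱ large)
...   | yes (v , d) = ≤-trans
        (few-edges G v
          (spider-free⇒within2 G j conn free v (≤-trans (m≤n+m (4 + j) 2) d)) no-path)
        -- Having at least four legs makes the coefficient `3 + j` at least 3.
        (*-monoˡ-≤ n (m≤m+n 3 j))
  where
  no-path : ∀ {a b c} → adj G v a ≡ true → adj G a b ≡ true → adj G b c ≡ true →
            b ≢ v → c ≢ v → c ≢ a → ⊥
  no-path {a} {b} {c} va ab bc b≢v c≢v c≢a = free (spider-embeds G j va ab bc b≢v c≢v c≢a
    -- Even if `a`, `b` and `c` are all neighbours of `v`, there remain `3 + j` short legs.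
    (+-cancelʳ-≤ 3 _ _ (begin
      j + 3 + 3 ≡⟨ +-assoc j 3 3 ⟩
      j + 6     ≡⟨ +-comm j 6 ⟩
      6 + j     ≤⟨ d ⟩
      deg G v   ≤⟨ degree≤leaves G v a b c ⟩
      _         ≤⟨ +-monoʳ-≤ (count (leaf G v a b c))
                     (+-mono-≤ (bool≤1 (adj G v a)) (+-mono-≤ (bool≤1 (adj G v b)) (bool≤1 (adj G v c)))) ⟩
      count (leaf G v a b c) + 3 ∎)))
    where open ≤-Reasoning

-- Sums over initial segments of ℕ

∑< : ∀ n → (ℕ → ℕ) → ℕ
∑< n F = sum {n} (F ∘ toℕ)

∑<-cong : ∀ n {F G : ℕ → ℕ} → (∀ i → i < n → F i ≡ G i) → ∑< n F ≡ ∑< n G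
∑<-cong n eq = sum-cong-≗ λ i → eq (toℕ i) (toℕ<n i)

∑<-+ : ∀ a {b} F → ∑< (a + b) F ≡ ∑< a F + ∑< b (F ∘ (a +_))
∑<-+ zero    F = refl
∑<-+ (suc a) F = trans (cong (F 0 +_) (∑<-+ a (F ∘ suc))) (≡-sym (+-assoc (F 0) _ _))

∑<-reverse : ∀ n F → ∑< n F ≡ ∑< n (λ i → F (n ∸ suc i))
∑<-reverse zero    F = refl
∑<-reverse (suc n) F = begin
  ∑< (suc n) F         ≡⟨ cong (λ k → ∑< k F) (+-comm 1 n) ⟩
  ∑< (n + 1) F         ≡⟨ ∑<-+ n F ⟩
  ∑< n F + (F (n + 0) + 0) ≡⟨ cong (∑< n F +_) (trans (+-identityʳ _) (cong F (+-identityʳ n))) ⟩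
  ∑< n F + F n         ≡⟨ +-comm (∑< n F) (F n) ⟩
  F n + ∑< n F         ≡⟨ cong (F n +_) (∑<-reverse n F) ⟩
  F n + ∑< n (λ i → F (n ∸ suc i)) ∎
  where open ≡-Reasoning

⟦∨⟧ : ∀ {a b} → (a ≡ true → b ≡ false) → ⟦ a ∨ b ⟧ ≡ ⟦ a ⟧ + ⟦ b ⟧
⟦∨⟧ {false} _ = refl
⟦∨⟧ {true}  f rewrite f refl = refl

<ᵇ-sound : ∀ {a b} → (a <ᵇ b) ≡ true → a < b
<ᵇ-sound {a} {b} e = <ᵇ⇒< a b (subst T (≡-sym e) tt)

∧-true : ∀ {a b} → a ∧ b ≡ true → a ≡ true × b ≡ true
∧-true {true} {true} _ = refl , refl

between : ℕ → ℕ → ℕ → Bool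
between k m d = (k <ᵇ d) ∧ (d <ᵇ suc (k + m))

between-≤ : ∀ k m d → between k m d ≡ true → d ≤ k + m
between-≤ k m d e = ≤-pred (<ᵇ-sound {d} (proj₂ (∧-true {k <ᵇ d} e)))

between-0 : ∀ k m → between k m 0 ≡ false
between-0 zero    m = refl
between-0 (suc k) m = refl

∑<-between : ∀ k m n → k + m < n → ∑< n (⟦_⟧ ∘ between k m) ≡ m
∑<-between zero m (suc n) (s≤s m≤n) = go m n m≤n
  where
  go : ∀ m n → m ≤ n → ∑< n (λ i → ⟦ i <ᵇ m ⟧) ≡ m
  go zero    n       _         = sum-replicate-zero n
  go (suc m) (suc n) (s≤s m≤n) = cong suc (go m n m≤n)
∑<-between (suc k) m (suc n) (s≤s lt) = ∑<-between k m n lt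

-- The extremal graph

-- Vertices are joined when one of the two ways round the `n`-cycle has length in the interval from
-- `k + 1` to `k + m`. By `wide`, the two ways never both qualify.
module Circulant (n k m : ℕ) (wide : (k + m) + (k + m) < n) where

  jump : ℕ → Bool
  jump d = between k m d ∨ between k m (n ∸ d)

  k+m<n : k + m < n
  k+m<n = ≤-<-trans (m≤m+n _ _) wide

  jump-0 : jump 0 ≡ false
  jump-0 = trans (cong (_∨ between k m n) (between-0 k m)) (¬-not (<⇒≱ k+m<n ∘ between-≤ k m n))

  jump-sym : ∀ d → d ≤ n → jump (n ∸ d) ≡ jump d
  jump-sym d d≤n rewrite m∸[m∸n]≡n d≤n = ∨-comm (between k m (n ∸ d)) (between k m d)

  ∑<-jump : ∑< n (⟦_⟧ ∘ jump) ≡ m + m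
  ∑<-jump = begin
    ∑< n (⟦_⟧ ∘ jump)
      ≡⟨ ∑<-cong n (λ d _ → ⟦∨⟧ (disjoint d)) ⟩
    ∑< n (λ d → b d + b (n ∸ d))
      ≡⟨ ∑-distrib-+ {n} (b ∘ toℕ) (λ i → b (n ∸ toℕ i)) ⟩
    ∑< n b + ∑< n (λ d → b (n ∸ d))
      ≡⟨ cong (∑< n b +_) (∑<-cong n (λ d d<n → cong b (+-∸-assoc 1 d<n))) ⟩
    ∑< n b + ∑< n (λ d → b (suc (n ∸ suc d)))
      ≡⟨ cong (∑< n b +_) (∑<-reverse n (b ∘ suc)) ⟨
    ∑< n b + ∑< n (b ∘ suc)
      -- For `d < n` the value `n ∸ d` runs over 1 to `n`. Prepending the zero term `b 0` turns this
      -- into a sum over an initial segment of length `suc n`.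
      ≡⟨ cong (λ x → ∑< n b + (x + ∑< n (b ∘ suc))) (cong ⟦_⟧ (between-0 k m)) ⟨
    ∑< n b + ∑< (suc n) b
      ≡⟨ cong₂ _+_ (∑<-between k m n k+m<n) (∑<-between k m (suc n) (m≤n⇒m≤1+n k+m<n)) ⟩
    m + m ∎
    where
    open ≡-Reasoning
    b : ℕ → ℕ
    b = ⟦_⟧ ∘ between k m
    disjoint : ∀ d → between k m d ≡ true → between k m (n ∸ d) ≡ false
    disjoint d e = ¬-not λ e′ → <⇒≱ wide (≤-trans (m≤n+m∸n n d)
      (+-mono-≤ (between-≤ k m d e) (between-≤ k m (n ∸ d) e′)))

  -- The row of `u` is split at `w ≡ u`. Vertices below give the distances 1 to `u`; those above
  -- give 1 to `b`, which the symmetry of `jump` reflects to `u + 1` up to `n ∸ 1`. Together each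
  -- nonzero jump is counted once.
  circulant-degree : ∀ u → u < n → ∑< n (λ w → ⟦ jump ∣ u - w ∣ ⟧) ≡ m + m
  circulant-degree u u<n with m≤n⇒∃[o]m+o≡n u<n
  ... | b , refl = begin
    ∑< (suc u + b) (λ w → F ∣ u - w ∣)
      ≡⟨ cong (λ k → ∑< k (λ w → F ∣ u - w ∣)) (+-suc u b) ⟨
    ∑< (u + suc b) (λ w → F ∣ u - w ∣)
      ≡⟨ ∑<-+ u (λ w → F ∣ u - w ∣) ⟩
    ∑< u (λ w → F ∣ u - w ∣) + (F ∣ u - u + 0 ∣ + ∑< b (λ i → F ∣ u - u + suc i ∣))
      ≡⟨ cong₂ _+_ below (cong₂ _+_ self above) ⟩
    ∑< u (F ∘ suc) + ∑< b (λ i → F (suc (u + i)))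
      ≡⟨ ∑<-+ u (F ∘ suc) ⟨
    ∑< (u + b) (F ∘ suc)
      ≡⟨ cong (λ x → ⟦ x ⟧ + ∑< (u + b) (F ∘ suc)) jump-0 ⟨
    ∑< (suc u + b) F
      ≡⟨ ∑<-jump ⟩
    m + m ∎
    where
    open ≡-Reasoning
    F : ℕ → ℕ
    F = ⟦_⟧ ∘ jump
    below : ∑< u (λ w → F ∣ u - w ∣) ≡ ∑< u (F ∘ suc)
    below = trans (∑<-reverse u (λ w → F ∣ u - w ∣)) (∑<-cong u λ i i<u → cong F
      (trans (m≤n⇒∣n-m∣≡n∸m (m∸n≤m u (suc i))) (m∸[m∸n]≡n i<u)))
    self : F ∣ u - u + 0 ∣ ≡ 0
    self = trans (cong F (∣m-m+n∣≡n u 0)) (cong ⟦_⟧ jump-0)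
    above : ∑< b (λ i → F ∣ u - u + suc i ∣) ≡ ∑< b (λ i → F (suc (u + i)))
    above = begin
      ∑< b (λ i → F ∣ u - u + suc i ∣) ≡⟨ ∑<-cong b (λ i _ → cong F (∣m-m+n∣≡n u (suc i))) ⟩
      ∑< b (F ∘ suc)                   ≡⟨ ∑<-reverse b (F ∘ suc) ⟩
      ∑< b (λ i → F (suc (b ∸ suc i))) ≡⟨ ∑<-cong b mirror ⟩
      ∑< b (λ i → F (suc (u + i)))     ∎
      where
      mirror : ∀ i → i < b → F (suc (b ∸ suc i)) ≡ F (suc (u + i))
      mirror i i<b = cong ⟦_⟧ (trans
        (≡-sym (jump-sym (suc (b ∸ suc i)) (s≤s (≤-trans (m∸n≤m b (suc i)) (m≤n+m b u)))))
        (cong jump (trans (+-∸-assoc u (m∸n≤m b (suc i)))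
                   (trans (cong (u +_) (m∸[m∸n]≡n i<b)) (+-suc u i)))))

-- The matching

-- Defined on all of ℕ; cut off at an odd `n`, it leaves the vertex `n ∸ 1` alone, whose partner
-- would be `n`.
matched : ℕ → ℕ → Bool
matched 0 1 = true
matched 1 0 = true
matched (suc (suc a)) (suc (suc b)) = matched a b
matched _ _ = false

matched-sym : ∀ a b → matched a b ≡ matched b a
matched-sym 0 0 = refl
matched-sym 0 1 = refl
matched-sym 0 (suc (suc b)) = refl
matched-sym 1 0 = refl
matched-sym 1 1 = refl
matched-sym 1 (suc (suc b)) = refl
matched-sym (suc (suc a)) 0 = refl
matched-sym (suc (suc a)) 1 = refl
matched-sym (suc (suc a)) (suc (suc b)) = matched-sym a b

matched-irrefl : ∀ a → matched a a ≡ false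
matched-irrefl 0 = refl
matched-irrefl 1 = refl
matched-irrefl (suc (suc a)) = matched-irrefl a

matched⇒distance1 : ∀ a b → matched a b ≡ true → ∣ a - b ∣ ≡ 1
matched⇒distance1 0 1 _ = refl
matched⇒distance1 1 0 _ = refl
matched⇒distance1 (suc (suc a)) (suc (suc b)) e = matched⇒distance1 a b e

∑<-matched≤1 : ∀ n u → ∑< n (⟦_⟧ ∘ matched u) ≤ 1
∑<-matched≤1 0 u = z≤n
∑<-matched≤1 1 0 = z≤n
∑<-matched≤1 1 1 = ≤-refl
∑<-matched≤1 1 (suc (suc u)) = z≤n
∑<-matched≤1 (suc (suc n)) 0 = ≤-reflexive (cong suc (sum-replicate-zero n))
∑<-matched≤1 (suc (suc n)) 1 = ≤-reflexive (cong suc (sum-replicate-zero n))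
∑<-matched≤1 (suc (suc n)) (suc (suc u)) = ∑<-matched≤1 n u

∑<-matched-total : ∀ n → ∑< n (λ u → ∑< n (⟦_⟧ ∘ matched u)) ≡ ⌊ n /2⌋ + ⌊ n /2⌋
∑<-matched-total 0 = refl
∑<-matched-total 1 = refl
∑<-matched-total (suc (suc n)) = begin
  suc (∑< n (λ _ → 0)) + (suc (∑< n (λ _ → 0)) + ∑< n (λ u → ∑< n (⟦_⟧ ∘ matched u)))
    ≡⟨ cong₂ (λ x y → suc x + (suc x + y)) (sum-replicate-zero n) (∑<-matched-total n) ⟩
  2 + (⌊ n /2⌋ + ⌊ n /2⌋)
    ≡⟨ cong suc (+-suc ⌊ n /2⌋ ⌊ n /2⌋) ⟨
  suc ⌊ n /2⌋ + suc ⌊ n /2⌋ ∎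
  where open ≡-Reasoning

-- Connectivity

reachable-trans : ∀ {n} (G : Graph n) {u v w} → Reachable G u v → Reachable G v w → Reachable G u w
reachable-trans G here       q = q
reachable-trans G (step e p) q = step e (reachable-trans G p q)

reachable-sym : ∀ {n} (G : Graph n) {u v} → Reachable G u v → Reachable G v u
reachable-sym G here       = here
reachable-sym G (step e p) = reachable-trans G (reachable-sym G p) (step (flip-adj G e) here)

-- Moving repeatedly to a neighbour of smaller index ends at vertex 0, so any two vertices are
-- connected through it.
descending⇒connected : ∀ {n} (G : Graph n) →
  (∀ u → toℕ u ≡ 0 ⊎ ∃ λ w → toℕ w < toℕ u × adj G u w ≡ true) → Connected G
descending⇒connected {suc n} G down u v =
  reachable-trans G (to-zero (toℕ u) u refl) (reachable-sym G (to-zero (toℕ v) v refl))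
  where
  to-zero : ∀ a u → toℕ u ≡ a → Reachable G u zero
  to-zero = <-rec _ λ { a rec u refl → descend rec u (down u) }
    where
    descend : ∀ {a} → (∀ {b} → b < a → ∀ u → toℕ u ≡ b → Reachable G u zero) →
              ∀ u → (toℕ u ≡ 0 ⊎ ∃ λ w → toℕ w < a × adj G u w ≡ true) → Reachable G u zero
    descend rec zero    _                     = here
    descend rec (suc u) (inj₂ (w , w<u , uw)) = step uw (rec w<u w refl)

∣c+a-a∣≡c : ∀ c a → ∣ c + a - a ∣ ≡ c
∣c+a-a∣≡c c a = trans (∣-∣-comm (c + a) a) (trans (cong (∣ a -_∣) (+-comm c a)) (∣m-m+n∣≡n a c))

-- The jumps start at length ⟦ ε ⟧ + 1, so when ε = 1 they avoid the matching, whose edges have length 1.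
module NearRegular (ε : Bool) (m n : ℕ) (wide : (⟦ ε ⟧ + suc m) + (⟦ ε ⟧ + suc m) < n) where

  open Circulant n ⟦ ε ⟧ (suc m) wide

  joined : ℕ → ℕ → Bool
  joined a b = jump ∣ a - b ∣ ∨ (ε ∧ matched a b)

  G : Graph n
  G = record
    { adj    = λ u w → joined (toℕ u) (toℕ w)
    ; sym    = λ u w → cong₂ _∨_ (cong jump (∣-∣-comm (toℕ u) (toℕ w))) (cong (ε ∧_) (matched-sym (toℕ u) (toℕ w)))
    ; irrefl = λ u → cong₂ _∨_ (trans (cong jump (∣n-n∣≡0 (toℕ u))) jump-0) (unmatched ε (toℕ u))
    }
    where
    unmatched : ∀ ε a → ε ∧ matched a a ≡ false
    unmatched false a = refl
    unmatched true  a = matched-irrefl a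

  partners : ℕ → ℕ
  partners a = ∑< n (λ b → ⟦ ε ∧ matched a b ⟧)

  degree : ∀ u → deg G u ≡ (suc m + suc m) + partners (toℕ u)
  degree u = begin
    deg G u
      ≡⟨ ∑<-cong n (λ b _ → ⟦∨⟧ (disjoint ε wide a b)) ⟩
    ∑< n (λ b → ⟦ jump ∣ a - b ∣ ⟧ + ⟦ ε ∧ matched a b ⟧)
      ≡⟨ ∑-distrib-+ {n} (λ w → ⟦ jump ∣ a - toℕ w ∣ ⟧) (λ w → ⟦ ε ∧ matched a (toℕ w) ⟧) ⟩
    ∑< n (λ b → ⟦ jump ∣ a - b ∣ ⟧) + partners a
      ≡⟨ cong (_+ partners a) (circulant-degree a (toℕ<n u)) ⟩
    (suc m + suc m) + partners a ∎
    where
    open ≡-Reasoning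
    a = toℕ u
    disjoint : ∀ ε wide a b → Circulant.jump n ⟦ ε ⟧ (suc m) wide ∣ a - b ∣ ≡ true → ε ∧ matched a b ≡ false
    disjoint false wide a b _ = refl
    -- Matched vertices are at distance 1, too short to be a jump when `k` is 1; the other way round
    -- has length `n ∸ 1`, too long by `wide`.
    disjoint true  wide a b jumps = ¬-not λ paired → <⇒≱ wide (long
      (trans (cong (Circulant.jump n 1 (suc m) wide) (≡-sym (matched⇒distance1 a b paired))) jumps))
      where
      long : between 1 (suc m) (n ∸ 1) ≡ true → n ≤ (1 + suc m) + (1 + suc m)
      long e = ≤-trans (m≤n+m∸n n 1) (+-mono-≤ {1} {1 + suc m} (s≤s z≤n) (between-≤ 1 (suc m) (n ∸ 1) e))

  degree≤ : ∀ u → deg G u ≤ (suc m + suc m) + ⟦ ε ⟧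
  degree≤ u = ≤-trans (≤-reflexive (degree u)) (+-monoʳ-≤ (suc m + suc m) (bound ε))
    where
    bound : ∀ ε → ∑< n (λ b → ⟦ ε ∧ matched (toℕ u) b ⟧) ≤ ⟦ ε ⟧
    bound false = ≤-reflexive (sum-replicate-zero n)
    bound true  = ∑<-matched≤1 n (toℕ u)

  -- The shortest jump descends by 1 if `ε` is `false` and by 2 if it is `true`; in the latter case
  -- vertex 1 reaches 0 by the matching.
  connected : Connected G
  connected = descending⇒connected G λ u →
    [ inj₁ , (λ { (a , a<u , e) → inj₂ (below a<u e) }) ]′ (down ε wide (toℕ u))
    where
    below : ∀ {u : Fin n} {a} → a < toℕ u → joined (toℕ u) a ≡ true →
            ∃ λ w → toℕ w < toℕ u × adj G u w ≡ true
    below {u} {a} a<u e = fromℕ< a<n , subst (_< toℕ u) (≡-sym eq) a<u ,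
      subst (λ x → joined (toℕ u) x ≡ true) (≡-sym eq) e
      where
      a<n = <-trans a<u (toℕ<n u)
      eq = toℕ-fromℕ< a<n
    down : ∀ ε wide b → b ≡ 0 ⊎ ∃ λ a → a < b ×
           Circulant.jump n ⟦ ε ⟧ (suc m) wide ∣ b - a ∣ ∨ (ε ∧ matched b a) ≡ true
    down ε     wide 0             = inj₁ refl
    down false wide (suc a)       = inj₂ (a , ≤-refl ,
      cong (λ d → Circulant.jump n 0 (suc m) wide d ∨ false) (∣c+a-a∣≡c 1 a))
    down true  wide 1             = inj₂ (0 , ≤-refl , ∨-zeroʳ _)
    down true  wide (suc (suc a)) = inj₂ (a , n≤1+n _ ,
      cong (λ d → Circulant.jump n 1 (suc m) wide d ∨ matched (2 + a) a) (∣c+a-a∣≡c 2 a))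

  -- The degree sum is at most `(R + ⟦ ε ⟧) * n` and falls short by at most 1, so halving it is
  -- rounding down.
  edges : edgeCount G ≡ (((suc m + suc m) + ⟦ ε ⟧) * n) / 2
  edges = ≤-antisym
    (≤-trans (≤-reflexive (≡-sym (m*n/n≡m (edgeCount G) 2))) (/-monoˡ-≤ 2 (begin
      edgeCount G * 2     ≡⟨ *-comm (edgeCount G) 2 ⟩
      2 * edgeCount G     ≡⟨ handshake G ⟩
      sum (deg G)         ≤⟨ sum-mono degree≤ ⟩
      sum {n} (λ _ → R + ⟦ ε ⟧) ≡⟨ sum-const n (R + ⟦ ε ⟧) ⟩
      n * (R + ⟦ ε ⟧)     ≡⟨ *-comm n (R + ⟦ ε ⟧) ⟩
      (R + ⟦ ε ⟧) * n ∎)))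
    (≤-pred (m<n*o⇒m/o<n {(R + ⟦ ε ⟧) * n} {suc (edgeCount G)} {2} (begin-strict
      (R + ⟦ ε ⟧) * n     ≡⟨ *-distribʳ-+ n R ⟦ ε ⟧ ⟩
      R * n + ⟦ ε ⟧ * n   ≡⟨ cong (_+ ⟦ ε ⟧ * n) (*-comm R n) ⟩
      -- The added 2 covers the one unmatched vertex that occurs for odd `n`.
      n * R + ⟦ ε ⟧ * n   <⟨ +-monoʳ-< (n * R) (slack ε) ⟩
      n * R + (2 + ∑< n (partners)) ≡⟨ +-suc (n * R) _ ⟩
      suc (n * R + suc (∑< n partners)) ≡⟨ cong suc (+-suc (n * R) _) ⟩
      2 + (n * R + ∑< n partners) ≡⟨ cong (λ s → 2 + (s + ∑< n partners)) (sum-const n R) ⟨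
      2 + (sum {n} (λ _ → R) + ∑< n partners) ≡⟨ cong (2 +_) (∑-distrib-+ {n} (λ _ → R) (partners ∘ toℕ)) ⟨
      2 + sum {n} (λ u → R + partners (toℕ u)) ≡⟨ cong (2 +_) (sum-cong-≗ degree) ⟨
      2 + sum (deg G)     ≡⟨ cong (2 +_) (handshake G) ⟨
      2 + 2 * edgeCount G ≡⟨ cong (2 +_) (*-comm 2 (edgeCount G)) ⟩
      suc (edgeCount G) * 2 ∎)))
    where
    open ≤-Reasoning
    R = suc m + suc m
    half : ∀ n → n < 2 + (⌊ n /2⌋ + ⌊ n /2⌋)
    half 0 = s≤s z≤n
    half 1 = s≤s (s≤s z≤n)
    half (suc (suc n)) = s≤s (s≤s (≤-trans (half n) (≤-reflexive (cong suc (≡-sym (+-suc ⌊ n /2⌋ ⌊ n /2⌋))))))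
    slack : ∀ ε → ⟦ ε ⟧ * n < 2 + ∑< n (λ a → ∑< n (λ b → ⟦ ε ∧ matched a b ⟧))
    slack false = s≤s z≤n
    slack true  = subst₂ (λ x y → x < 2 + y) (≡-sym (+-identityʳ n)) (≡-sym (∑<-matched-total n)) (half n)

-- Parity of the degree and the final theorem

halve : ∀ i → ∃ λ m → ∃ λ ε → i ≡ m + m + ⟦ ε ⟧
halve 0 = 0 , false , refl
halve 1 = 0 , true , refl
halve (suc (suc i)) with halve i
... | m , ε , refl = suc m , ε , cong (λ x → suc (x + ⟦ ε ⟧)) (≡-sym (+-suc m m))

theorem1p10 : ∀ (j : ℕ) → 4 ≤ j →
    Σ ℕ λ N → ∀ (n : ℕ) → N ≤ n → ExC≡ n (spider3 j) (((j ∸ 1) * n) / 2)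
theorem1p10 _ (s≤s (s≤s (s≤s (s≤s (z≤n {i}))))) =
  -- One more than the Moore bound for degree `D`, so that `N ≤ n` is literally the strict
  -- inequality asked by `upper-bound`.
  2 + (D + D * D) , λ n large → extremal n large , λ G conn free →
    ≤-trans (≤-reflexive (≡-sym (m*n/n≡m (edgeCount G) 2)))
      (/-monoˡ-≤ 2 (≤-trans (≤-reflexive (*-comm (edgeCount G) 2)) (upper-bound G i large conn free)))
  where
  D = 5 + i
  extremal : ∀ n → 1 + (D + D * D) < n → Σ (Graph n) λ G →
    Connected G × (Contains G (spider3 (4 + i)) → ⊥) × edgeCount G ≡ ((3 + i) * n) / 2
  -- Halving `1 + i` instead of `3 + i` makes the half-degree of the circulant a successor `suc m`,
  -- so it always has jumps.
  extremal n large with halve (suc i)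
  ... | m , ε , eq = G , connected , free , trans edges (cong (λ r → r * n / 2) (≡-sym r≡))
    where
    r≡ : 3 + i ≡ (suc m + suc m) + ⟦ ε ⟧
    r≡ = trans (cong (2 +_) eq) (cong (λ x → suc (x + ⟦ ε ⟧)) (≡-sym (+-suc m m)))
    wide : (⟦ ε ⟧ + suc m) + (⟦ ε ⟧ + suc m) < n
    -- The threshold for the upper bound also suffices here, since each jump length is at most `D`.
    wide = ≤-<-trans (begin
      (⟦ ε ⟧ + suc m) + (⟦ ε ⟧ + suc m) ≤⟨ +-mono-≤ bound bound ⟩
      D + D                             ≤⟨ +-monoʳ-≤ D (m≤m*n D D) ⟩
      D + D * D                         ≤⟨ n≤1+n _ ⟩
      1 + (D + D * D)                   ∎) large
      where
      open ≤-Reasoning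
      bound : ⟦ ε ⟧ + suc m ≤ D
      bound = begin
        ⟦ ε ⟧ + suc m             ≡⟨ +-comm ⟦ ε ⟧ (suc m) ⟩
        suc m + ⟦ ε ⟧             ≤⟨ +-monoˡ-≤ ⟦ ε ⟧ (m≤m+n (suc m) (suc m)) ⟩
        (suc m + suc m) + ⟦ ε ⟧   ≡⟨ r≡ ⟨
        3 + i                     ≤⟨ m≤n+m (3 + i) 2 ⟩
        D                         ∎
    open NearRegular ε m n wide
    free : ¬ Contains G (spider3 (4 + i))
    free c with spider⇒degree G i c
    ... | v , large = <⇒≱ (s≤s (degree≤ v)) (≤-trans (≤-reflexive (cong suc (≡-sym r≡))) large)
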